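{- Let $G$ be a graph of order $n$ such that $\gamma(G)=\beta(G)$, and let $t\ge 3$ be an integer. The following assertions are equivalent: (a) $\gamma(S(G,t))=n^{t-1}\gamma(G)$; (b) $\xi(G)=0$ and there exists a unique $\gamma(G)$-set.
   Context: A set $D\subseteq V$ is dominating in $G=(V,E)$ if every vertex of $V\setminus D$ has a neighbour in $D$; the domination number $\gamma(G)$ is the minimum cardinality of a dominating set, and a dominating set of cardinality $\gamma(G)$ is a $\gamma(G)$-set. $\beta(G)$ is the vertex cover number (minimum cardinality of a set of vertices meeting every edge). Let $\mathcal D(G)$ be the set of all $\gamma(G)$-sets. Define $\xi(G)=\max_{D\in\mathcal D(G)}\{|D'|:\ D'\subseteq D \text{ and the subgraph induced by } D' \text{ has no isolated vertices}\}$ (the empty set is allowed). For a positive integer $t$, $V^t$ denotes the set of words $u=u_1\cdots u_t$ of length $t$ over $V$. The generalized Sierpiński graph $S(G,t)$ has vertex set $V^t$, and $\{u,v\}$ is an edge if and only if there is $i\in\{1,\dots,t\}$ such that: (i) $u_j=v_j$ for all $j<i$; (ii) $u_i\ne v_i$ and $\{u_i,v_i\}\in E$; (iii) $u_j=v_i$ and $v_j=u_i$ for all $j>i$. -}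

module Defs where

open import Data.Nat using (ℕ; _≤_)
open import Data.Fin using (Fin; _<_)
open import Data.Vec using (Vec; lookup)
open import Data.List using (List; length)
open import Data.List.Membership.Propositional using (_∈_)
open import Data.List.Relation.Unary.Unique.Propositional using (Unique)
open import Data.Product using (Σ; ∃; _×_; _,_)
open import Data.Sum using (_⊎_; inj₁; inj₂)
open import Data.Empty using (⊥)
open import Relation.Nullary using (¬_)
open import Relation.Binary.PropositionalEquality using (_≡_; refl; sym)
open import Function.Bundles using (_⇔_)

record Graph (V : Set) : Set₁ where
  field
    Adj    : V → V → Set
    symAdj : ∀ {u v} → Adj u v → Adj v u
    irrAdj : ∀ {u} → ¬ Adj u u
open Graph public

-- Vertex sets are duplicate-free lists; cardinality is length.
IsSet : {V : Set} → List V → Set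
IsSet D = Unique D

_⊆_ : {V : Set} → List V → List V → Set
A ⊆ B = ∀ {x} → x ∈ A → x ∈ B

SameSet : {V : Set} → List V → List V → Set
SameSet A B = ∀ x → (x ∈ A) ⇔ (x ∈ B)

IsDominating : {V : Set} → Graph V → List V → Set
IsDominating {V} G D = ∀ (v : V) → v ∈ D ⊎ Σ V (λ u → u ∈ D × Adj G u v)

IsGammaSet : {V : Set} → Graph V → List V → Set
IsGammaSet G D = IsSet D × IsDominating G D ×
  (∀ D′ → IsSet D′ → IsDominating G D′ → length D ≤ length D′)

IsDominationNumber : {V : Set} → Graph V → ℕ → Set
IsDominationNumber {V} G k = Σ (List V) (λ D → IsGammaSet G D × length D ≡ k)

IsVertexCover : {V : Set} → Graph V → List V → Set
IsVertexCover G C = ∀ u v → Adj G u v → u ∈ C ⊎ v ∈ C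

IsVertexCoverNumber : {V : Set} → Graph V → ℕ → Set
IsVertexCoverNumber {V} G k = Σ (List V) (λ C → IsSet C × IsVertexCover G C × length C ≡ k ×
  (∀ C′ → IsSet C′ → IsVertexCover G C′ → k ≤ length C′))

NoIsolated : {V : Set} → Graph V → List V → Set
NoIsolated {V} G D′ = ∀ {x} → x ∈ D′ → Σ V (λ y → y ∈ D′ × Adj G x y)

XiCandidate : {V : Set} → Graph V → List V → List V → Set
XiCandidate G D D′ = IsGammaSet G D × IsSet D′ × D′ ⊆ D × NoIsolated G D′

-- ξ(G) = k (maximum over all candidates; the empty D′ is allowed)
IsXi : {V : Set} → Graph V → ℕ → Set
IsXi {V} G k =
  Σ (List V) (λ D → Σ (List V) (λ D′ → XiCandidate G D D′ × length D′ ≡ k)) ×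
  (∀ D D′ → XiCandidate G D D′ → length D′ ≤ k)

UniqueGammaSet : {V : Set} → Graph V → Set
UniqueGammaSet {V} G = Σ (List V) (λ D → IsGammaSet G D × (∀ D′ → IsGammaSet G D′ → SameSet D D′))

SAdj : ∀ {n} → Graph (Fin n) → (t : ℕ) → Vec (Fin n) t → Vec (Fin n) t → Set
SAdj {n} G t u v = Σ (Fin t) λ i →
  (∀ j → j < i → lookup u j ≡ lookup v j) ×
  ¬ (lookup u i ≡ lookup v i) × Adj G (lookup u i) (lookup v i) ×
  (∀ j → i < j → lookup u j ≡ lookup v i × lookup v j ≡ lookup u i)

S : ∀ {n} → Graph (Fin n) → (t : ℕ) → Graph (Vec (Fin n) t)
S {n} G t = record { Adj = SAdj G t ; symAdj = λ {u} {v} → sy {u} {v} ; irrAdj = λ {u} → ir {u} }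
  where
  sy : ∀ {u v} → SAdj G t u v → SAdj G t v u
  sy {u} {v} (i , a , b , c , d) = i , (λ j j<i → sym (a j j<i)) , (λ e → b (sym e)) , symAdj G {lookup u i} {lookup v i} c ,
    (λ j i<j → let (p , q) = d j i<j in q , p)
  ir : ∀ {u} → ¬ SAdj G t u u
  ir {u} (i , a , b , c , d) = b refl

{-# OPTIONS --safe #-}
module Submission where

-- For a vertex list of S(G,t) and a word w of length t − 1, let D_w be its fibre over the copy of G at w.
-- (b) ⇒ (a): if a is the last letter of w, then within the copy at w only w a and its neighbours can be dominated from
-- other copies, so D_w ∪ {a} dominates G. Hence |D_w| < γ forces D_w = D ∖ {a} for the unique γ-set D; as D is
-- independent, w a is dominated through its cross edge, from the copy at the "twin" w′ = u a zʳ of w = u z aʳ. The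
-- fibre there contains its own last letter z ∉ D, so it dominates G but is not D, and has more than γ elements. Twinning is an involution,
-- so the fibres have average size at least γ.
-- (a) ⇒ (b): two adjacent vertices in a γ-set, or two different γ-sets, give a dominating set with a redundant vertex.

open import Defs
open import Data.Fin using (Fin; zero; suc) renaming (_<_ to _<ᶠ_)
open import Data.Fin.Properties using () renaming (_≟_ to _≟ᶠ_)
open import Data.Nat using (ℕ; zero; suc; _+_; _≤_; _<_; _*_; _^_; _∸_; z≤n; s≤s; _<?_)
open import Data.Nat.Properties
  using (≤-refl; ≤-reflexive; ≤-trans; ≤-antisym; ≤∧≢⇒<; ≮⇒≥; <⇒≱; +-mono-≤; +-mono-<;
         +-suc; +-comm; *-distribˡ-+; module ≤-Reasoning)
open import Data.Nat.ListAction using (sum)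
open import Data.Nat.ListAction.Properties using (sum-↭)
open import Algebra.Properties.CommutativeSemigroup Data.Nat.Properties.+-commutativeSemigroup using (interchange)
open import Data.Vec using (Vec; []; _∷_; _∷ʳ_; replicate; lookup; last; initLast)
open import Data.Vec.Properties using (≡-dec; ∷-injective; ∷ʳ-injective; ∷ʳ-injectiveˡ; ∷ʳ-injectiveʳ; lookup-replicate)
open import Data.List using (List; []; _∷_; _++_; length; map; concatMap; filter; allFin; cartesianProductWith)
open import Data.List.Properties using (length-++; length-map; length-tabulate; filter-notAll; map-cong; map-∘)
open import Data.List.Membership.Propositional using (_∈_; _∉_)
open import Data.List.Membership.Propositional.Properties
  using (∈-∃++; ∈-map⁺; ∈-map⁻; ∈-filter⁺; ∈-filter⁻; ∈-allFin; ∈-concatMap⁺; ∈-concatMap⁻; ∈-cartesianProductWith⁺)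
open import Data.List.Membership.Propositional.Properties.WithK using (unique∧set⇒bag)
import Data.List.Membership.DecPropositional as DecMembership
open import Data.List.Relation.Binary.BagAndSetEquality using (∼bag⇒↭)
open import Data.List.Relation.Binary.Permutation.Propositional using (_↭_)
open import Data.List.Relation.Binary.Permutation.Propositional.Properties using (↭-length; shift; ∈-resp-↭)
  renaming (map⁺ to ↭-map⁺)
open import Data.List.Relation.Binary.Disjoint.Propositional using (Disjoint)
open import Data.List.Relation.Unary.All using ([]; _∷_) renaming (lookup to All-lookup; tabulate to All-tabulate)
import Data.List.Relation.Unary.All.Properties as All
open import Data.List.Relation.Unary.Any using (here; there)
import Data.List.Relation.Unary.Any as Any
import Data.List.Relation.Unary.AllPairs as AllPairs
import Data.List.Relation.Unary.AllPairs.Properties as AllPairs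
open import Data.List.Relation.Unary.Unique.Propositional using (Unique; []; _∷_)
import Data.List.Relation.Unary.Unique.Propositional.Properties as Unique
open import Data.Product using (∃; ∃₂; _×_; _,_; proj₁; proj₂)
open import Data.Sum using (_⊎_; inj₁; inj₂)
open import Data.Empty using (⊥-elim)
open import Function using (_∘_; id)
open import Function.Bundles using (_⇔_; mk⇔; Equivalence)
open import Relation.Nullary using (¬_; Dec; yes; no; ¬?; contradiction)
open import Relation.Binary.PropositionalEquality
  using (_≡_; _≢_; refl; sym; trans; cong; cong₂; subst)

-- Counting in finite lists; constant words.

Unique-⊆⇒length≤ : ∀ {A : Set} {xs ys : List A} → Unique xs → xs ⊆ ys → length xs ≤ length ys
Unique-⊆⇒length≤ {xs = []} _ _ = z≤n
Unique-⊆⇒length≤ {xs = x ∷ xs} (x∉xs ∷ uxs) xs⊆ys with ∈-∃++ (xs⊆ys (here refl))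
... | ys₁ , ys₂ , refl = ≤-trans (s≤s (Unique-⊆⇒length≤ uxs xs⊆rest)) (≤-reflexive (sym (↭-length (shift x ys₁ ys₂))))
  where
  xs⊆rest : xs ⊆ (ys₁ ++ ys₂)
  xs⊆rest z∈xs with ∈-resp-↭ (shift x ys₁ ys₂) (xs⊆ys (there z∈xs))
  ... | here refl = contradiction refl (All-lookup x∉xs z∈xs)
  ... | there z∈ = z∈

module _ {A : Set} where

  sum-map-const : ∀ {f : A → ℕ} {c} → (∀ x → f x ≡ c) → ∀ xs → sum (map f xs) ≡ length xs * c
  sum-map-const f≡c []       = refl
  sum-map-const f≡c (x ∷ xs) = cong₂ _+_ (f≡c x) (sum-map-const f≡c xs)

  sum-map-≥ : ∀ {f : A → ℕ} {c} → (∀ x → c ≤ f x) → ∀ xs → length xs * c ≤ sum (map f xs)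
  sum-map-≥ c≤f []       = z≤n
  sum-map-≥ c≤f (x ∷ xs) = +-mono-≤ (c≤f x) (sum-map-≥ c≤f xs)

  sum-map-+ : ∀ (f h : A → ℕ) xs → sum (map (λ x → f x + h x) xs) ≡ sum (map f xs) + sum (map h xs)
  sum-map-+ f h []       = refl
  sum-map-+ f h (x ∷ xs) = trans (cong (f x + h x +_) (sum-map-+ f h xs))
    (interchange (f x) (h x) (sum (map f xs)) (sum (map h xs)))

  length-concatMap : ∀ {B : Set} (f : A → List B) xs → length (concatMap f xs) ≡ sum (map (length ∘ f) xs)
  length-concatMap f []       = refl
  length-concatMap f (x ∷ xs) = trans (length-++ (f x)) (cong (length (f x) +_) (length-concatMap f xs))

length-cartesianProductWith : ∀ {A B C : Set} (f : A → B → C) xs ys →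
  length (cartesianProductWith f xs ys) ≡ length xs * length ys
length-cartesianProductWith f []       ys = refl
length-cartesianProductWith f (x ∷ xs) ys = trans (length-++ (map (f x) ys))
  (cong₂ _+_ (length-map (f x) ys) (length-cartesianProductWith f xs ys))

lookup-const : ∀ {A : Set} {m} {c : A} (v : Vec A m) → (∀ j → lookup v j ≡ c) → v ≡ replicate m c
lookup-const []      _    = refl
lookup-const (x ∷ v) v≡c = cong₂ _∷_ (v≡c zero) (lookup-const v (v≡c ∘ suc))

replicate-∷ʳ : ∀ {A : Set} m (x : A) → replicate m x ∷ʳ x ≡ replicate (suc m) x
replicate-∷ʳ zero    x = refl
replicate-∷ʳ (suc m) x = cong (x ∷_) (replicate-∷ʳ m x)

∷ʳ-replicate⁻ : ∀ {A : Set} {m} {x y : A} (w : Vec A m) → w ∷ʳ x ≡ replicate (suc m) y → w ≡ replicate m y × x ≡ y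
∷ʳ-replicate⁻ {m = m} {y = y} w e = ∷ʳ-injective w (replicate m y) (trans e (sym (replicate-∷ʳ m y)))

last-replicate : ∀ {A : Set} m (x : A) → last (replicate (suc m) x) ≡ x
last-replicate zero    x = refl
last-replicate (suc m) x = last-replicate m x

-- Words, the twin involution, and vertex sets given copy by copy.

module _ {n : ℕ} where

  Word : ℕ → Set
  Word = Vec (Fin n)

  _≟ʷ_ : ∀ {m} (u v : Word m) → Dec (u ≡ v)
  _≟ʷ_ = ≡-dec _≟ᶠ_

  words : ∀ m → List (Word m)
  words zero    = [] ∷ []
  words (suc m) = cartesianProductWith _∷_ (allFin n) (words m)

  ∈-words : ∀ {m} (w : Word m) → w ∈ words m
  ∈-words []      = here refl
  ∈-words (a ∷ w) = ∈-cartesianProductWith⁺ _∷_ (∈-allFin a) (∈-words w)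

  words-unique : ∀ m → Unique (words m)
  words-unique zero    = [] ∷ []
  words-unique (suc m) = Unique.cartesianProductWith⁺ _∷_ ∷-injective (Unique.allFin⁺ n) (words-unique m)

  length-words : ∀ m → length (words m) ≡ n ^ m
  length-words zero    = refl
  length-words (suc m) = trans (length-cartesianProductWith _∷_ (allFin n) (words m))
    (cong₂ _*_ {y = n} (length-tabulate {n = n} id) (length-words m))

  -- Both lists are duplicate-free with the same members, hence equal as bags. This allows sums over
  -- all copies to be reindexed by `twin`.
  involution-↭ : ∀ {m} (f : Word m → Word m) → (∀ w → f (f w) ≡ w) → map f (words m) ↭ words m
  involution-↭ {m} f f² = ∼bag⇒↭ (unique∧set⇒bag
    (Unique.map⁺ (λ {u} {v} e → trans (sym (f² u)) (trans (cong f e) (f² v))) (words-unique m))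
    (words-unique m)
    (λ {w} → mk⇔ (λ _ → ∈-words w) (λ _ → subst (_∈ map f (words m)) (f² w) (∈-map⁺ f (∈-words (f w))))))

  -- The involution u z aʳ ↔ u a zʳ on nonconstant words (z ≠ a, r ≥ 1).
  twin : ∀ {m} → Word m → Word m
  pivot : ∀ {m} → Fin n → Word m → Word m → Word (suc m)

  twin []      = []
  twin (a ∷ w) = pivot a w (twin w)

  pivot a []      _ = a ∷ []
  pivot {suc m} a (b ∷ w) w′ with w ≟ʷ replicate m b
  -- The tail is constant, so the last change of letter is here; if `a` equals `b` there is none and
  -- the word stays fixed.
  ... | yes _ = b ∷ replicate (suc m) a
  ... | no  _ = a ∷ w′

  twin-turn : ∀ m a b → twin (a ∷ replicate (suc m) b) ≡ b ∷ replicate (suc m) a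
  twin-turn m a b with replicate m b ≟ʷ replicate m b
  ... | yes _ = refl
  ... | no ¬p = contradiction refl ¬p

  twin-const : ∀ m a → twin (replicate m a) ≡ replicate m a
  twin-const zero          a = refl
  twin-const (suc zero)    a = refl
  twin-const (suc (suc m)) a = twin-turn m a a

  twin-∷ : ∀ {m} a (w : Word (suc m)) → (∀ b → w ≢ replicate (suc m) b) → twin (a ∷ w) ≡ a ∷ twin w
  twin-∷ {m} a (b ∷ w) nonconst with w ≟ʷ replicate m b
  ... | yes e = contradiction (cong (b ∷_) e) (nonconst b)
  ... | no _  = refl

  -- A second swap undoes the first. Without a swap the tail is nonconstant, and so is its twin
  -- because `twin` fixes constant words; hence both passes recurse into the tail.
  pivot-involutive : ∀ {m} a (w : Word m) → twin (twin w) ≡ w → twin (twin (a ∷ w)) ≡ a ∷ w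
  pivot-involutive a [] _ = refl
  pivot-involutive {suc m} a (b ∷ w) w² with w ≟ʷ replicate m b
  ... | yes e = trans (twin-turn m b a) (cong (λ v → a ∷ b ∷ v) (sym e))
  ... | no ne = trans (twin-∷ a (twin (b ∷ w)) nonconst) (cong (a ∷_) w²)
    where
    nonconst : ∀ c → twin (b ∷ w) ≢ replicate (suc m) c
    nonconst c e with trans (sym w²) (trans (cong twin e) (twin-const (suc m) c))
    ... | refl = ne refl

  twin-involutive : ∀ {m} (w : Word m) → twin (twin w) ≡ w
  twin-involutive []      = refl
  twin-involutive (a ∷ w) = pivot-involutive a w (twin-involutive w)

  family : ∀ {m} → (Word m → List (Fin n)) → List (Word (suc m))
  family {m} E = concatMap (λ w → map (w ∷ʳ_) (E w)) (words m)

  module _ {m} {E : Word m → List (Fin n)} where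

    ∈-family⁺ : ∀ {w x} → x ∈ E w → (w ∷ʳ x) ∈ family E
    ∈-family⁺ {w} x∈ = ∈-concatMap⁺ _ (Any.map (λ { refl → ∈-map⁺ (w ∷ʳ_) x∈ }) (∈-words w))

    ∈-family⁻ : ∀ {v} → v ∈ family E → ∃₂ λ w x → x ∈ E w × v ≡ w ∷ʳ x
    ∈-family⁻ v∈ with Any.satisfied (∈-concatMap⁻ _ {xs = words m} v∈)
    ... | w , v∈w with ∈-map⁻ (w ∷ʳ_) v∈w
    ... | x , x∈ , v≡ = w , x , x∈ , v≡

    family-unique : (∀ w → Unique (E w)) → Unique (family E)
    family-unique uE = Unique.concat⁺
      (All.map⁺ (All-tabulate λ {w} _ → Unique.map⁺ (∷ʳ-injectiveʳ w w) (uE w)))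
      (AllPairs.map⁺ (AllPairs.map disjoint (words-unique m)))
      where
      disjoint : ∀ {w w′} → w ≢ w′ → Disjoint (map (w ∷ʳ_) (E w)) (map (w′ ∷ʳ_) (E w′))
      disjoint {w} {w′} w≢w′ (v∈ , v∈′) with ∈-map⁻ (w ∷ʳ_) v∈ | ∈-map⁻ (w′ ∷ʳ_) v∈′
      ... | _ , _ , e | _ , _ , e′ = w≢w′ (∷ʳ-injectiveˡ w w′ (trans (sym e) e′))

    length-family : length (family E) ≡ sum (map (length ∘ E) (words m))
    length-family = trans (length-concatMap _ (words m))
      (cong sum (map-cong (λ w → length-map (w ∷ʳ_) (E w)) (words m)))

    length-family-const : ∀ {c} → (∀ w → length (E w) ≡ c) → length (family E) ≡ n ^ m * c
    length-family-const {c} e =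
      trans length-family (trans (sum-map-const e (words m)) (cong (_* c) (length-words m)))

-- Edges of S(G,t), within and between the copies of G.

module _ {n : ℕ} (G : Graph (Fin n)) where

  -- `SAdj` by recursion on the common prefix instead of by a position; `turn` sits at the first
  -- differing letter.
  data Edge : ∀ {t} → Vec (Fin n) t → Vec (Fin n) t → Set where
    turn : ∀ {t x y} → Adj G x y → Edge (x ∷ replicate t y) (y ∷ replicate t x)
    keep : ∀ {t a} {u v : Vec (Fin n) t} → Edge u v → Edge (a ∷ u) (a ∷ v)

  Edge-irrefl : ∀ {t} {v : Vec (Fin n) t} → ¬ Edge v v
  Edge-irrefl {v = _ ∷ _} (turn xx) = irrAdj G xx
  Edge-irrefl {v = _ ∷ _} (keep e)  = Edge-irrefl e

  SAdj⇒Edge : ∀ {t} {u v : Vec (Fin n) t} → SAdj G t u v → Edge u v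
  SAdj⇒Edge {u = x ∷ u} {y ∷ v} (zero , _ , _ , xy , tails)
    with lookup-const u (λ j → proj₁ (tails (suc j) (s≤s z≤n))) | lookup-const v (λ j → proj₂ (tails (suc j) (s≤s z≤n)))
  ... | refl | refl = turn xy
  SAdj⇒Edge {u = x ∷ u} {y ∷ v} (suc i , heads , x≢y , xy , tails) with heads zero (s≤s z≤n)
  ... | refl = keep (SAdj⇒Edge
    (i , (λ j j<i → heads (suc j) (s≤s j<i)) , x≢y , xy , λ j i<j → tails (suc j) (s≤s i<j)))

  Edge⇒SAdj : ∀ {t} {u v : Vec (Fin n) t} → Edge u v → SAdj G t u v
  Edge⇒SAdj (turn {x = x} {y} xy) = zero , (λ _ ()) , (λ { refl → irrAdj G xy }) , xy ,
    λ { (suc j) _ → lookup-replicate j y , lookup-replicate j x }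
  Edge⇒SAdj {u = a ∷ u} {_ ∷ v} (keep e) with Edge⇒SAdj e
  ... | i , heads , x≢y , xy , tails = suc i , heads′ , x≢y , xy , λ { (suc j) (s≤s i<j) → tails j i<j }
    where
    heads′ : ∀ j → j <ᶠ suc i → lookup (a ∷ u) j ≡ lookup (a ∷ v) j
    heads′ zero    _         = refl
    heads′ (suc j) (s≤s j<i) = heads j j<i

  Edge-within : ∀ {m} (w : Vec (Fin n) m) {x y} → Adj G x y → Edge (w ∷ʳ x) (w ∷ʳ y)
  Edge-within []      xy = turn xy
  Edge-within (a ∷ w) xy = keep (Edge-within w xy)

  Edge-between : ∀ {m} (w : Vec (Fin n) m) {x y} → Adj G x y → Edge (w ∷ʳ x ∷ʳ y) (w ∷ʳ y ∷ʳ x)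
  Edge-between []      xy = turn xy
  Edge-between (a ∷ w) xy = keep (Edge-between w xy)

  -- A cross edge whose two ends are both words with a doubled last letter. It takes at least three
  -- letters, which is where `t ≥ 3` enters.
  Edge-between² : ∀ {m} (w : Vec (Fin n) m) {x y} → Adj G x y → Edge (w ∷ʳ x ∷ʳ y ∷ʳ y) (w ∷ʳ y ∷ʳ x ∷ʳ x)
  Edge-between² []      xy = turn xy
  Edge-between² (a ∷ w) xy = keep (Edge-between² w xy)

  -- Cross w b w′ c: the vertices w b and w′ c are joined by an edge between the copies of G at w and w′.
  data Cross : ∀ {m} → Vec (Fin n) (suc m) → Fin n → Vec (Fin n) (suc m) → Fin n → Set where
    turn : ∀ {m x y} → Adj G x y → Cross (x ∷ replicate m y) y (y ∷ replicate m x) x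
    keep : ∀ {m a b c} {w w′ : Vec (Fin n) (suc m)} → Cross w b w′ c → Cross (a ∷ w) b (a ∷ w′) c

  -- The words have at least two letters, so a `turn` at the head changes the copy; only a turn at
  -- the very last letter stays within one.
  Edge-split : ∀ {m} (w w′ : Vec (Fin n) (suc m)) {b c} → Edge (w ∷ʳ b) (w′ ∷ʳ c) →
               (w ≡ w′ × Adj G b c) ⊎ Cross w b w′ c
  Edge-split w w′ e = split w w′ e refl refl
    where
    split : ∀ {m} (w w′ : Vec (Fin n) (suc m)) {b c u v} → Edge u v → u ≡ w ∷ʳ b → v ≡ w′ ∷ʳ c →
            (w ≡ w′ × Adj G b c) ⊎ Cross w b w′ c
    split (x ∷ w) (y ∷ w′) (turn xy) p q
      with ∷-injective p | ∷-injective q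
    ... | refl , p′ | refl , q′
      with ∷ʳ-replicate⁻ w (sym p′) | ∷ʳ-replicate⁻ w′ (sym q′)
    ... | refl , refl | refl , refl = inj₂ (turn xy)
    split (a ∷ []) (a′ ∷ []) (keep (turn bc)) refl refl = inj₁ (refl , bc)
    split (a ∷ w@(_ ∷ _)) (a′ ∷ w′@(_ ∷ _)) (keep e) p q
      with ∷-injective p | ∷-injective q
    ... | refl , p′ | refl , q′ with split w w′ e p′ q′
    ... | inj₁ (refl , bc) = inj₁ (refl , bc)
    ... | inj₂ cr          = inj₂ (keep cr)

  -- If `w` and `w′` first differ in their last letter, `b` is adjacent to `last w`; if they differ
  -- earlier, `w` already ends in `b`.
  Cross-last : ∀ {m} {w w′ : Vec (Fin n) (suc m)} {b c} → Cross w b w′ c → b ≡ last w ⊎ Adj G (last w) b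
  Cross-last (turn {zero} xy)      = inj₂ xy
  Cross-last (turn {suc m} {y = y} xy) = inj₁ (sym (last-replicate m y))
  Cross-last {suc m} {w = _ ∷ _ ∷ _} (keep cr) = Cross-last cr

  Cross-irrefl : ∀ {m} {w : Vec (Fin n) (suc m)} {b c} → ¬ Cross w b w c
  Cross-irrefl (turn xx) = irrAdj G xx
  Cross-irrefl (keep cr) = Cross-irrefl cr

  -- A first difference in the last letter of `w` would now be a loop. So `w` is u z bʳ with r ≥ 1,
  -- and the other end is u b zʳ followed by z.
  Cross-twin : ∀ {m} {w w′ : Vec (Fin n) (suc m)} {b c} → Cross w b w′ c → b ≡ last w →
               w′ ≡ twin w × c ≡ last w′ × Adj G c b
  Cross-twin (turn {zero} xy) refl = contradiction xy (irrAdj G)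
  Cross-twin (turn {suc m} {x} {y} xy) _ = sym (twin-turn m x y) , sym (last-replicate m x) , xy
  Cross-twin {suc m} {a ∷ w@(_ ∷ _)} {_ ∷ w′@(_ ∷ _)} {b} {c} (keep cr) b≡ with Cross-twin cr b≡
  ... | w′≡ , c≡ , cb = trans (cong (a ∷_) w′≡) (sym (twin-∷ a w nonconst)) , c≡ , cb
    where
    -- A constant tail is its own twin, and the cross edge would join a copy to itself.
    nonconst : ∀ d → w ≢ replicate (suc m) d
    nonconst d refl = Cross-irrefl (subst (λ v → Cross w b v c) (trans w′≡ (twin-const (suc m) d)) cr)

  -- Minimum dominating sets and `ξ` of the base graph.

  γ-length : ∀ {D D′} → IsGammaSet G D → IsGammaSet G D′ → length D ≡ length D′
  γ-length (uD , dD , minD) (uD′ , dD′ , minD′) = ≤-antisym (minD _ uD′ dD′) (minD′ _ uD dD)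

  γ-minimal : ∀ {D D′} → IsGammaSet G D → IsSet D′ → IsDominating G D′ → length D′ ≤ length D → IsGammaSet G D′
  γ-minimal (_ , _ , minD) uD′ dD′ D′≤D = uD′ , dD′ , λ D″ u d → ≤-trans D′≤D (minD D″ u d)

  pair-noIsolated : ∀ {x y} → Adj G x y → NoIsolated G (x ∷ y ∷ [])
  pair-noIsolated xy (here refl)         = _ , there (here refl) , xy
  pair-noIsolated xy (there (here refl)) = _ , here refl , symAdj G xy

  -- An adjacent pair in `D` would be a candidate of size 2.
  ξ≡0⇒independent : IsXi G 0 → ∀ {D x y} → IsGammaSet G D → x ∈ D → y ∈ D → ¬ Adj G x y
  ξ≡0⇒independent (_ , ξ≤0) {D} {x} {y} γD x∈ y∈ xy with ξ≤0 D (x ∷ y ∷ [])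
    (γD , ((λ { refl → irrAdj G xy }) ∷ []) ∷ [] ∷ [] ,
     (λ { (here refl) → x∈ ; (there (here refl)) → y∈ }) , pair-noIsolated xy)
  ... | ()

  -- (b) ⇒ (a), lower bound: small fibres are compensated by their twins.

  module _ {D} (γD : IsGammaSet G D) (unique : ∀ D′ → IsGammaSet G D′ → SameSet D D′)
           (independent : ∀ {x y} → x ∈ D → y ∈ D → ¬ Adj G x y)
           {m} {X : List (Vec (Fin n) (suc (suc m)))} (dX : IsDominating (S G _) X) where

    open DecMembership (_≟ʷ_ {n} {suc (suc m)}) using (_∈?_)

    minD : ∀ D′ → IsSet D′ → IsDominating G D′ → length D ≤ length D′
    minD = proj₂ (proj₂ γD)

    fibre : Vec (Fin n) (suc m) → List (Fin n)
    fibre w = filter (λ x → (w ∷ʳ x) ∈? X) (allFin n)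

    ∈-fibre⁺ : ∀ {w x} → (w ∷ʳ x) ∈ X → x ∈ fibre w
    ∈-fibre⁺ {w} {x} = ∈-filter⁺ (λ x → (w ∷ʳ x) ∈? X) (∈-allFin x)

    ∈-fibre⁻ : ∀ {w x} → x ∈ fibre w → (w ∷ʳ x) ∈ X
    ∈-fibre⁻ {w} x∈ = proj₂ (∈-filter⁻ (λ x → (w ∷ʳ x) ∈? X) {xs = allFin n} x∈)

    fibre-unique : ∀ w → Unique (fibre w)
    fibre-unique w = Unique.filter⁺ (λ x → (w ∷ʳ x) ∈? X) (Unique.allFin⁺ n)

    dominated : ∀ w b → b ∈ fibre w ⊎ (∃ λ c → c ∈ fibre w × Adj G c b) ⊎
                        (∃₂ λ w′ c → Cross w b w′ c × c ∈ fibre w′)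
    dominated w b with dX (w ∷ʳ b)
    ... | inj₁ wb∈ = inj₁ (∈-fibre⁺ wb∈)
    ... | inj₂ (v , v∈ , adj) with initLast v
    ... | w′ , c , refl with Edge-split w w′ (SAdj⇒Edge (symAdj (S G _) {w′ ∷ʳ c} {w ∷ʳ b} adj))
    ... | inj₁ (refl , bc) = inj₂ (inj₁ (c , ∈-fibre⁺ v∈ , symAdj G bc))
    ... | inj₂ cr          = inj₂ (inj₂ (w′ , c , cr , ∈-fibre⁺ v∈))

    -- By `Cross-last`, whatever is dominated from another copy is `last w` or adjacent to it.
    fibre+last-dominating : ∀ w → IsDominating G (last w ∷ fibre w)
    fibre+last-dominating w b with dominated w b
    ... | inj₁ b∈                     = inj₁ (there b∈)
    ... | inj₂ (inj₁ (c , c∈ , cb))   = inj₂ (c , there c∈ , cb)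
    ... | inj₂ (inj₂ (_ , _ , cr , _)) with Cross-last cr
    ... | inj₁ refl = inj₁ (here refl)
    ... | inj₂ ab   = inj₂ (last w , here refl , ab)

    last∈⇒dominating : ∀ w → last w ∈ fibre w → IsDominating G (fibre w)
    last∈⇒dominating w a∈ b with fibre+last-dominating w b
    ... | inj₁ (here refl)             = inj₁ a∈
    ... | inj₁ (there b∈)              = inj₁ b∈
    ... | inj₂ (_ , here refl , ab)    = inj₂ (last w , a∈ , ab)
    ... | inj₂ (c , there c∈ , cb)     = inj₂ (c , c∈ , cb)

    -- The fibre dominates G; with only γ elements it would be the unique γ-set `D`, which misses
    -- `last w`.
    last∈∖D⇒large : ∀ w → last w ∈ fibre w → last w ∉ D → length D < length (fibre w)
    last∈∖D⇒large w a∈ a∉D = ≤∧≢⇒< (minD _ (fibre-unique w) dom) λ eq →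
      a∉D (Equivalence.from (unique _ (γ-minimal γD (fibre-unique w) dom (≤-reflexive (sym eq))) (last w)) a∈)
      where
      dom : IsDominating G (fibre w)
      dom = last∈⇒dominating w a∈

    small⇒twin-large : ∀ w → length (fibre w) < length D →
                       length D ≤ suc (length (fibre w)) × length D < length (fibre (twin w))
    small⇒twin-large w small = minD _ uF⁺ (fibre+last-dominating w) , large (dominated w (last w))
      where
      a∉F : last w ∉ fibre w
      a∉F a∈ = <⇒≱ small (minD _ (fibre-unique w) (last∈⇒dominating w a∈))
      uF⁺ : Unique (last w ∷ fibre w)
      uF⁺ = All.¬Any⇒All¬ _ a∉F ∷ fibre-unique w
      F⁺⊆D : (last w ∷ fibre w) ⊆ D
      -- `small` unfolds to the bound `suc (length (fibre w)) ≤ length D` on the enlarged fibre,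
      -- which is therefore `D` as a set.
      F⁺⊆D = Equivalence.from (unique _ (γ-minimal γD uF⁺ (fibre+last-dominating w) small) _)
      a∈D : last w ∈ D
      a∈D = F⁺⊆D (here refl)
      large : last w ∈ fibre w ⊎ (∃ λ c → c ∈ fibre w × Adj G c (last w)) ⊎
              (∃₂ λ w′ c → Cross w (last w) w′ c × c ∈ fibre w′) → length D < length (fibre (twin w))
      large (inj₁ a∈)                    = contradiction a∈ a∉F
      large (inj₂ (inj₁ (c , c∈ , ca)))  = contradiction ca (independent (F⁺⊆D (there c∈)) a∈D)
      -- The dominating vertex lies in the twin copy and repeats its last letter `c`; being adjacent
      -- to `last w` in the independent set `D`, `c` is outside `D`.
      large (inj₂ (inj₂ (w′ , c , cr , c∈))) with Cross-twin cr refl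
      ... | refl , refl , ca = last∈∖D⇒large (twin w) c∈ λ c∈D → independent c∈D a∈D ca

    -- The fibre at `w` falls short of γ by at most one, and the one at its twin exceeds γ by at
    -- least one.
    small⇒balanced : ∀ w → length (fibre w) < length D →
                     length D + length D ≤ length (fibre w) + length (fibre (twin w))
    small⇒balanced w small with small⇒twin-large w small
    ... | D≤ , D< = begin
      length D + length D                          ≤⟨ +-mono-≤ D≤ ≤-refl ⟩
      suc (length (fibre w)) + length D            ≡⟨ +-suc _ _ ⟨
      length (fibre w) + suc (length D)            ≤⟨ +-mono-≤ (≤-refl {length (fibre w)}) D< ⟩
      length (fibre w) + length (fibre (twin w))   ∎
      where open ≤-Reasoning

    balanced : ∀ w → length D + length D ≤ length (fibre w) + length (fibre (twin w))
    balanced w with length (fibre w) <? length D | length (fibre (twin w)) <? length D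
    ... | yes small | _         = small⇒balanced w small
    -- Here the twin is the small one; its own twin is `w`, so the summands only change places.
    ... | no _      | yes small = subst (length D + length D ≤_)
      (trans (cong (λ v → length (fibre (twin w)) + length (fibre v)) (twin-involutive w))
             (+-comm (length (fibre (twin w))) _))
      (small⇒balanced (twin w) small)
    ... | no big    | no big′   = +-mono-≤ (≮⇒≥ big) (≮⇒≥ big′)

    -- Summing `balanced` over all copies counts every fibre twice, because `twin` permutes the
    -- copies; then halve. The fibres reassemble to a duplicate-free list inside `X`.
    lower-bound : n ^ suc m * length D ≤ length X
    lower-bound = ≤-trans (half fibres≤) (≤-trans (≤-reflexive (sym (length-family {E = fibre}))) family≤)
      where
      f : Vec (Fin n) (suc m) → ℕ
      f = length ∘ fibre
      ws : List (Vec (Fin n) (suc m))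
      ws = words (suc m)
      half : ∀ {a b} → a + a ≤ b + b → a ≤ b
      half a+a≤b+b = ≮⇒≥ λ b<a → <⇒≱ (+-mono-< b<a b<a) a+a≤b+b
      sum-twin : sum (map (f ∘ twin) ws) ≡ sum (map f ws)
      sum-twin = trans (cong sum (map-∘ ws)) (sum-↭ (↭-map⁺ f (involution-↭ twin twin-involutive)))
      open ≤-Reasoning
      fibres≤ : n ^ suc m * length D + n ^ suc m * length D ≤ sum (map f ws) + sum (map f ws)
      fibres≤ = begin
        n ^ suc m * length D + n ^ suc m * length D  ≡⟨ *-distribˡ-+ (n ^ suc m) (length D) (length D) ⟨
        n ^ suc m * (length D + length D)            ≡⟨ cong (_* (length D + length D)) (length-words {n} (suc m)) ⟨
        length ws * (length D + length D)            ≤⟨ sum-map-≥ balanced ws ⟩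
        sum (map (λ w → f w + f (twin w)) ws)        ≡⟨ sum-map-+ f (f ∘ twin) ws ⟩
        sum (map f ws) + sum (map (f ∘ twin) ws)     ≡⟨ cong (sum (map f ws) +_) sum-twin ⟩
        sum (map f ws) + sum (map f ws)              ∎
      family⊆ : family fibre ⊆ X
      family⊆ v∈ with ∈-family⁻ v∈
      ... | _ , _ , x∈ , refl = ∈-fibre⁻ x∈
      family≤ : length (family fibre) ≤ length X
      family≤ = Unique-⊆⇒length≤ (family-unique fibre-unique) family⊆

  -- (b) ⇒ (a), upper bound: one dominating set per copy.

  family-dominating : ∀ {m} {E : Vec (Fin n) m → List (Fin n)} → (∀ w → IsDominating G (E w)) →
                      IsDominating (S G (suc m)) (family E)
  family-dominating dE v with initLast v
  ... | w , b , refl with dE w b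
  ... | inj₁ b∈            = inj₁ (∈-family⁺ b∈)
  ... | inj₂ (c , c∈ , cb) = inj₂ (w ∷ʳ c , ∈-family⁺ c∈ , Edge⇒SAdj (Edge-within w cb))

  -- Repeating `D` in every copy attains the lower bound.
  unique∧ξ≡0⇒γ : ∀ {D} m → IsGammaSet G D → (∀ D′ → IsGammaSet G D′ → SameSet D D′) → IsXi G 0 →
                 IsDominationNumber (S G (suc (suc m))) (n ^ suc m * length D)
  unique∧ξ≡0⇒γ {D} m γD@(uD , dD , _) unique ξ≡0 =
    family (λ _ → D) ,
    (family-unique (λ _ → uD) , family-dominating (λ _ → dD) , λ X _ dX →
      ≤-trans (≤-reflexive size) (lower-bound γD unique (ξ≡0⇒independent ξ≡0 γD) dX)) ,
    size
    where
    size : length (family {m = suc m} (λ _ → D)) ≡ n ^ suc m * length D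
    size = length-family-const {m = suc m} {E = λ _ → D} (λ _ → refl)

  -- (a) ⇒ (b): independence, then uniqueness, of γ-sets.

  module _ {D m} (γD : IsGammaSet G D) (γS : IsDominationNumber (S G (suc (suc m))) (n ^ suc m * length D)) where

    -- If E picks a γ-set in every copy, then dropping the vertex u x x would beat γ(S(G,t)): its neighbours
    -- u x b in the copy at u x stay dominated by u b x.
    no-redundant : ∀ {E : Vec (Fin n) (suc m) → List (Fin n)} → (∀ w → IsGammaSet G (E w)) →
                   ∀ (u : Vec (Fin n) m) {x} → x ∈ E (u ∷ʳ x) → (∀ {b} → Adj G x b → x ∈ E (u ∷ʳ b)) →
                   ∀ {v} → v ∈ family E → ¬ Edge v (u ∷ʳ x ∷ʳ x)
    no-redundant {E} γE u {x} x∈ x∈nbr {v} v∈ v–v₀ = contradiction (proj₂ (proj₂ (proj₁ (proj₂ γS))) X′ uX′ dX′) (<⇒≱ X′<)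
      where
      v₀ : Vec (Fin n) (suc (suc m))
      v₀ = u ∷ʳ x ∷ʳ x
      P? : ∀ v → Dec (v ≢ v₀)
      P? v = ¬? (v ≟ʷ v₀)
      X′ : List (Vec (Fin n) (suc (suc m)))
      X′ = filter P? (family E)
      uX′ : Unique X′
      uX′ = Unique.filter⁺ P? (family-unique (proj₁ ∘ γE))
      X′< : length X′ < length (proj₁ γS)
      -- All γ-sets have equal size, so the family is as large as the γ-set in `γS`; filtering
      -- removes at least `v₀`.
      X′< = ≤-trans (filter-notAll P? _ (Any.map (λ { refl v≢v → v≢v refl }) (∈-family⁺ {E = E} x∈)))
        (≤-reflexive (trans (length-family-const (λ w → γ-length (γE w) γD)) (sym (proj₂ (proj₂ γS)))))
      dX′ : IsDominating (S G (suc (suc m))) X′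
      dX′ v′ with initLast v′
      ... | w , b , refl with (w ∷ʳ b) ≟ʷ v₀
      ... | yes e = inj₂ (v , ∈-filter⁺ P? v∈ (λ { refl → Edge-irrefl v–v₀ }) ,
                          Edge⇒SAdj (subst (Edge v) (sym e) v–v₀))
      ... | no ≢v₀ with proj₁ (proj₂ (γE w)) b
      ... | inj₁ b∈ = inj₁ (∈-filter⁺ P? (∈-family⁺ b∈) ≢v₀)
      ... | inj₂ (c , c∈ , cb) with (w ∷ʳ c) ≟ʷ v₀
      ... | no wc≢ = inj₂ (w ∷ʳ c , ∈-filter⁺ P? (∈-family⁺ c∈) wc≢ , Edge⇒SAdj (Edge-within w cb))
      ... | yes e with ∷ʳ-injective w (u ∷ʳ x) e
      ... | refl , refl = inj₂ (u ∷ʳ b ∷ʳ x ,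
        ∈-filter⁺ P? (∈-family⁺ (x∈nbr cb)) (λ e′ → b≢x (∷ʳ-injectiveʳ u u (∷ʳ-injectiveˡ (u ∷ʳ b) (u ∷ʳ x) e′))) ,
        Edge⇒SAdj (Edge-between u (symAdj G cb)))
        where
        b≢x : b ≢ x
        b≢x refl = irrAdj G cb

    -- With `D′` in every copy, the constant word in `x` is redundant: changing its last letter to
    -- `y` gives a neighbour that is also in the family.
    γ⇒independent : ∀ {D′ x y} → IsGammaSet G D′ → x ∈ D′ → y ∈ D′ → ¬ Adj G x y
    γ⇒independent {D′} {x} {y} γD′ x∈ y∈ xy =
      no-redundant (λ _ → γD′) (replicate m x) x∈ (λ _ → x∈)
        (∈-family⁺ {E = λ _ → D′} y∈) (Edge-within (replicate m x ∷ʳ x) (symAdj G xy))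

    γ⇒ξ≡0 : IsXi G 0
    γ⇒ξ≡0 = (D , [] , (γD , [] , (λ ()) , λ ()) , refl) , bound
      where
      bound : ∀ D D′ → XiCandidate G D D′ → length D′ ≤ 0
      bound _ []      _                       = z≤n
      bound _ (x ∷ _) (γD , _ , ⊆D , nonIso) with nonIso (here refl)
      ... | y , y∈ , xy = ⊥-elim (γ⇒independent γD (⊆D (here refl)) (⊆D y∈) xy)

  module _ {D m} (γD : IsGammaSet G D)
           (γS : IsDominationNumber (S G (suc (suc (suc m)))) (n ^ suc (suc m) * length D)) where

    open DecMembership (_≟ᶠ_ {n}) using (_∈?_)

    -- If x ∈ D₁ ∖ D₂ has the neighbour z ∈ D₂, use D₂ in the copy at u x z and D₁ in all other copies: then u x z z
    -- dominates u z x x, which is therefore redundant.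
    γ-set-⊆ : ∀ {D₁ D₂} → IsGammaSet G D₁ → IsGammaSet G D₂ → D₁ ⊆ D₂
    γ-set-⊆ {D₁} {D₂} γ₁ γ₂ {x} x∈₁ with x ∈? D₂
    ... | yes x∈₂ = x∈₂
    ... | no x∉₂ with proj₁ (proj₂ γ₂) x
    ... | inj₁ x∈₂            = x∈₂
    -- With prefix `u z` the dropped vertex is u z x x. The copies at u z b differ from the
    -- exceptional one at u x z since z ≠ x, so each of them contains `x`.
    ... | inj₂ (z , z∈₂ , zx) = ⊥-elim (no-redundant γD γS γE (u ∷ʳ z) (E-other x) (λ _ → E-other _)
        (∈-family⁺ {E = E} z∈E) (Edge-between² u (symAdj G zx)))
      where
      u : Vec (Fin n) m
      -- Any prefix of length `m` would do.
      u = replicate m x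
      E : Vec (Fin n) (suc (suc m)) → List (Fin n)
      E w with w ≟ʷ (u ∷ʳ x ∷ʳ z)
      ... | yes _ = D₂
      ... | no  _ = D₁
      γE : ∀ w → IsGammaSet G (E w)
      γE w with w ≟ʷ (u ∷ʳ x ∷ʳ z)
      ... | yes _ = γ₂
      ... | no  _ = γ₁
      z∈E : z ∈ E (u ∷ʳ x ∷ʳ z)
      z∈E with (u ∷ʳ x ∷ʳ z) ≟ʷ (u ∷ʳ x ∷ʳ z)
      ... | yes _ = z∈₂
      ... | no ≢  = contradiction refl ≢
      z≢x : z ≢ x
      z≢x refl = irrAdj G zx
      E-other : ∀ b → x ∈ E (u ∷ʳ z ∷ʳ b)
      E-other b with (u ∷ʳ z ∷ʳ b) ≟ʷ (u ∷ʳ x ∷ʳ z)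
      ... | yes e = ⊥-elim (z≢x (∷ʳ-injectiveʳ u u (∷ʳ-injectiveˡ (u ∷ʳ z) (u ∷ʳ x) e)))
      ... | no _  = x∈₁

theorem15 : (n : ℕ) (G : Graph (Fin n)) (g : ℕ) → IsDominationNumber G g → IsVertexCoverNumber G g →
    (t : ℕ) → 3 ≤ t →
    IsDominationNumber (S G t) (n ^ (t ∸ 1) * g) ⇔ (IsXi G 0 × UniqueGammaSet G)
theorem15 n G _ (D , γD , refl) _ (suc (suc (suc m))) (s≤s (s≤s (s≤s z≤n))) = mk⇔
  -- Uniqueness is inclusion in both directions, from `γ-set-⊆` with the two γ-sets interchanged.
  (λ γS → γ⇒ξ≡0 G γD γS , D , γD , λ D′ γD′ _ → mk⇔ (γ-set-⊆ G γD γS γD γD′) (γ-set-⊆ G γD γS γD′ γD))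
  (λ { (ξ≡0 , D′ , γD′ , unique) → subst (λ g → IsDominationNumber (S G (suc (suc (suc m)))) (n ^ suc (suc m) * g))
    (γ-length G γD′ γD) (unique∧ξ≡0⇒γ G (suc m) γD′ unique ξ≡0) })
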